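{- Let $E=\{e_1,\dots,e_n\}$ be a finite set, let $\mathcal{R}$ be the quantitative theory of reading computations of type $E$, and let $\mathcal{U}$ be a basic quantitative equational theory (of a type disjoint from that of $\mathcal{R}$). Then $(T_{\mathcal{U}}-)^{\underline{E}}$, with its canonical composite monad structure, is the free monad on the theory $\mathcal{U}\otimes\mathcal{R}$ in $\mathbf{Met}$; i.e. it is isomorphic as a monad to $T_{\mathcal{U}\otimes\mathcal{R}}$.
   Context: An extended metric space is a set $X$ with $d_X:X\times X\to[0,\infty]$ satisfying $d_X(x,y)=0$ iff $x=y$, symmetry and the triangle inequality. $\mathbf{Met}$ is the category of extended metric spaces and non-expansive maps. Quantitative theories. A signature $\Sigma$ is a set of function symbols $f:n$ of finite arity $n\in\mathbb{N}$. Fix a countably infinite set of variables $V$; terms are $\Sigma$-terms over $V$. A quantitative equation is an expression $t=_\varepsilon s$ with $t,s$ terms and $\varepsilon\in\mathbb{Q}_{\ge0}$. A conditional quantitative equation is $\Gamma\vdash t=_\varepsilon s$ with $\Gamma$ a finite set of quantitative equations. A quantitative equational theory of type $\Sigma$ is a set $\mathcal{U}$ of conditional quantitative equations containing (for all variables and rationals $\varepsilon,\varepsilon'\ge 0$) $\vdash x=_0x$; $\{x=_\varepsilon y\}\vdash y=_\varepsilon x$; $\{x=_\varepsilon z,z=_{\varepsilon'}y\}\vdash x=_{\varepsilon+\varepsilon'}y$; $\{x=_\varepsilon y\}\vdash x=_{\varepsilon+\varepsilon'}y$ for $\varepsilon'>0$; $\{x_i=_\varepsilon y_i\mid i=1,\dots,n\}\vdash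 f(x_1,\dots,x_n)=_\varepsilon f(y_1,\dots,y_n)$ for $f:n\in\Sigma$; and closed under: continuity (if $\Gamma\vdash t=_{\varepsilon'}s\in\mathcal{U}$ for all $\varepsilon'>\varepsilon$ then $\Gamma\vdash t=_\varepsilon s\in\mathcal{U}$), substitution of terms for variables, assumption ($\Gamma\vdash\phi\in\mathcal{U}$ whenever $\phi\in\Gamma$), and cut (if $\Gamma\vdash\phi\in\mathcal{U}$ for all $\phi\in\Theta$ and $\Theta\vdash\psi\in\mathcal{U}$ then $\Gamma\vdash\psi\in\mathcal{U}$). A set $A$ of conditional quantitative equations axiomatizes $\mathcal{U}$ if $\mathcal{U}$ is the smallest theory containing $A$. $\mathcal{U}$ is basic if it is axiomatized by a set of conditional quantitative equations of the form $\{x_1=_{\varepsilon_1}y_1,\dots,x_n=_{\varepsilon_n}y_n\}\vdash t=_\varepsilon s$ with all $x_i,y_i$ variables. Models. A quantitative $\Sigma$-algebra is an extended metric space $A$ with, for each $f:n\in\Sigma$, a map $f^A:A^n\to A$ that is non-expansive for the max metric on $A^n$. It satisfies $\Gamma\vdash t=_\varepsilon s$ if for every assignment $\iota:V\to A$ (extended homomorphically to terms), $d_A(\iota(t'),\iota(s'))\le\varepsilon'$ for all $t'=_{\varepsilon'}s'\in\Gamma$ implies $d_A(\iota(t),\iota(s))\le\varepsilon$. $\mathbb{K}(\Sigma,\mathcal{U})$ is the category of quantitative $\Sigma$-algebras satisfying all members of $\mathcal{U}$, with non-expansive $\Sigma$-homomorphisms. The forgetful functor $\mathbb{K}(\Sigma,\mathcal{U})\to\mathbf{Met}$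 has a left adjoint (known result); $T_{\mathcal{U}}$ denotes the induced monad on $\mathbf{Met}$, called the free monad on $\mathcal{U}$. Tensor of theories. For theories of disjoint types $\Sigma,\Sigma'$, $\mathcal{U}\otimes\mathcal{U}'$ is the smallest quantitative equational theory of type $\Sigma\cup\Sigma'$ containing $\mathcal{U}$, $\mathcal{U}'$ and, for all $f:n\in\Sigma$ and $g:m\in\Sigma'$, the equation $$\vdash f(g(x^1_1,\dots,x^1_m),\dots,g(x^n_1,\dots,x^n_m))=_0 g(f(x^1_1,\dots,x^n_1),\dots,f(x^1_m,\dots,x^n_m)).$$ Reader theory. $\mathcal{R}$ has signature $\{\mathsf{r}:n\}$, $n=|E|$, and is axiomatized by $\vdash x=_0\mathsf{r}(x,\dots,x)$ and $\vdash\mathsf{r}(x_{1,1},\dots,x_{n,n})=_0\mathsf{r}(\mathsf{r}(x_{1,1},\dots,x_{1,n}),\dots,\mathsf{r}(x_{n,1},\dots,x_{n,n}))$. Composite monad. $X^{\underline{E}}$ is the set of all maps $E\to X$ with metric $\sup_{e\in E}d_X(f(e),g(e))$. For $T=T_{\mathcal{U}}$ with unit $\eta$ and multiplication $\mu$, $(T-)^{\underline{E}}$ sends $X$ to $(TX)^{\underline{E}}$, has unit $x\mapsto(e\mapsto\eta_X(x))$ and multiplication sending $g\in(T((TX)^{\underline{E}}))^{\underline{E}}$ to $e\mapsto\mu_X(T(\mathrm{ev}_e)(g(e)))$, where $\mathrm{ev}_e$ is evaluation at $e$. -}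

module Defs where

open import Level using (Level; _⊔_) renaming (suc to lsuc)
open import Data.Nat.Base using (ℕ)
open import Data.Fin.Base using (Fin)
open import Data.Unit.Polymorphic.Base using (⊤; tt)
open import Data.Product.Base using (_×_; _,_; proj₁; proj₂; ∃-syntax)
open import Data.Sum.Base using (_⊎_; inj₁; inj₂; [_,_]′)
open import Data.List.Base using (List; []; _∷_; [_]; map; tabulate)
open import Data.List.Membership.Propositional using (_∈_)
open import Data.List.Relation.Unary.All using (All)
open import Data.Vec.Functional using (Vector)
open import Data.Rational.Base as ℚ using (ℚ; 0ℚ)
import Data.Rational.Properties as ℚₚ
open import Relation.Unary using (Pred; _⊆_)
open import Relation.Binary.Bundles using (Setoid)
open import Relation.Binary.Structures using (IsEquivalence)
open import Function.Bundles using (_⇔_; mk⇔; Equivalence)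

private
  variable
    ℓ o h e : Level

record Category (o h e : Level) : Set (lsuc (o ⊔ h ⊔ e)) where
  infix  4 _≈_ _⇒_
  infixr 9 _∘_
  field
    Obj      : Set o
    _⇒_      : Obj → Obj → Set h
    _≈_      : ∀ {A B} → A ⇒ B → A ⇒ B → Set e
    id       : ∀ {A} → A ⇒ A
    _∘_      : ∀ {A B C} → B ⇒ C → A ⇒ B → A ⇒ C
    equiv    : ∀ {A B} → IsEquivalence (_≈_ {A} {B})
    ∘-resp-≈ : ∀ {A B C} {f f′ : B ⇒ C} {g g′ : A ⇒ B} →
               f ≈ f′ → g ≈ g′ → f ∘ g ≈ f′ ∘ g′
    assoc    : ∀ {A B C D} {f : A ⇒ B} {g : B ⇒ C} {k : C ⇒ D} →
               (k ∘ g) ∘ f ≈ k ∘ (g ∘ f)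
    identityˡ : ∀ {A B} {f : A ⇒ B} → id ∘ f ≈ f
    identityʳ : ∀ {A B} {f : A ⇒ B} → f ∘ id ≈ f

  hom-setoid : ∀ A B → Setoid h e
  hom-setoid A B = record { isEquivalence = equiv {A} {B} }

record Functor {o h e o′ h′ e′} (C : Category o h e) (D : Category o′ h′ e′)
       : Set (o ⊔ h ⊔ e ⊔ o′ ⊔ h′ ⊔ e′) where
  private
    module C = Category C
    module D = Category D
  field
    F₀           : C.Obj → D.Obj
    F₁           : ∀ {A B} → A C.⇒ B → F₀ A D.⇒ F₀ B
    F-resp-≈     : ∀ {A B} {f g : A C.⇒ B} → f C.≈ g → F₁ f D.≈ F₁ g
    identity     : ∀ {A} → F₁ (C.id {A}) D.≈ D.id
    homomorphism : ∀ {X Y Z} {f : X C.⇒ Y} {g : Y C.⇒ Z} →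
                   F₁ (g C.∘ f) D.≈ F₁ g D.∘ F₁ f

record Monad (C : Category o h e) : Set (o ⊔ h ⊔ e) where
  open Category C
  field
    functor : Functor C C
  open Functor functor public
  field
    η         : ∀ X → X ⇒ F₀ X
    μ         : ∀ X → F₀ (F₀ X) ⇒ F₀ X
    η-natural : ∀ {X Y} (f : X ⇒ Y) → η Y ∘ f ≈ F₁ f ∘ η X
    μ-natural : ∀ {X Y} (f : X ⇒ Y) → μ Y ∘ F₁ (F₁ f) ≈ F₁ f ∘ μ X
    μ-assoc   : ∀ {X} → μ X ∘ F₁ (μ X) ≈ μ X ∘ μ (F₀ X)
    unitˡ     : ∀ {X} → μ X ∘ F₁ (η X) ≈ id
    unitʳ     : ∀ {X} → μ X ∘ η (F₀ X) ≈ id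

record MonadMorphism {C : Category o h e} (S T : Monad C) : Set (o ⊔ h ⊔ e) where
  open Category C
  private
    module S = Monad S
    module T = Monad T
  field
    σ       : ∀ X → S.F₀ X ⇒ T.F₀ X
    natural : ∀ {X Y} (f : X ⇒ Y) → σ Y ∘ S.F₁ f ≈ T.F₁ f ∘ σ X
    unit    : ∀ {X} → σ X ∘ S.η X ≈ T.η X
    mult    : ∀ {X} → σ X ∘ S.μ X ≈ T.μ X ∘ (σ (T.F₀ X) ∘ S.F₁ (σ X))

record MonadIso {C : Category o h e} (S T : Monad C) : Set (o ⊔ h ⊔ e) where
  open Category C
  field
    to   : MonadMorphism S T
    from : MonadMorphism T S
  private
    module to   = MonadMorphism to
    module from = MonadMorphism from
  field
    isoˡ : ∀ {X} → from.σ X ∘ to.σ X ≈ id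
    isoʳ : ∀ {X} → to.σ X ∘ from.σ X ≈ id

record LeftAdjoint {o h e o′ h′ e′} {C : Category o h e} {D : Category o′ h′ e′}
       (G : Functor D C) : Set (o ⊔ h ⊔ e ⊔ o′ ⊔ h′ ⊔ e′) where
  private
    module C = Category C
    module D = Category D
    module G = Functor G
  field
    F : Functor C D
  private module F = Functor F
  field
    unit           : ∀ X → X C.⇒ G.F₀ (F.F₀ X)
    counit         : ∀ A → F.F₀ (G.F₀ A) D.⇒ A
    unit-natural   : ∀ {X Y} (f : X C.⇒ Y) →
                     unit Y C.∘ f C.≈ G.F₁ (F.F₁ f) C.∘ unit X
    counit-natural : ∀ {A B} (f : A D.⇒ B) →
                     counit B D.∘ F.F₁ (G.F₁ f) D.≈ f D.∘ counit A
    zig            : ∀ {X} → counit (F.F₀ X) D.∘ F.F₁ (unit X) D.≈ D.id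
    zag            : ∀ {A} → G.F₁ (counit A) C.∘ unit (G.F₀ A) C.≈ C.id

inducedMonad : ∀ {o h e o′ h′ e′} {C : Category o h e} {D : Category o′ h′ e′}
               {G : Functor D C} → LeftAdjoint G → Monad C
inducedMonad {C = C} {D} {G} L = record
  { functor = record
    { F₀           = λ X → G.F₀ (F.F₀ X)
    ; F₁           = λ f → G.F₁ (F.F₁ f)
    ; F-resp-≈     = λ eq → G.F-resp-≈ (F.F-resp-≈ eq)
    ; identity     = Ceq.trans (G.F-resp-≈ F.identity) G.identity
    ; homomorphism = Ceq.trans (G.F-resp-≈ F.homomorphism) G.homomorphism
    }
  ; η         = unit
  ; μ         = λ X → G.F₁ (counit (F.F₀ X))
  ; η-natural = unit-natural
  ; μ-natural = λ f → square (counit-natural (F.F₁ f))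
  ; μ-assoc   = square (counit-natural (counit _))
  ; unitˡ     = Ceq.trans (Ceq.sym G.homomorphism)
                  (Ceq.trans (G.F-resp-≈ zig) G.identity)
  ; unitʳ     = zag
  }
  where
  module C = Category C
  module D = Category D
  module G = Functor G
  open LeftAdjoint L
  module F = Functor F
  module Ceq {A B} = IsEquivalence (C.equiv {A} {B})
  square : ∀ {P Q R S} {f : P D.⇒ Q} {g : Q D.⇒ S} {k : P D.⇒ R} {l : R D.⇒ S} →
           g D.∘ f D.≈ l D.∘ k → G.F₁ g C.∘ G.F₁ f C.≈ G.F₁ l C.∘ G.F₁ k
  square eq = Ceq.trans (Ceq.sym G.homomorphism)
                (Ceq.trans (G.F-resp-≈ eq) G.homomorphism)

record ℚ≥0 : Set where
  constructor mk≥0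
  field
    value       : ℚ
    .{{nonNeg}} : ℚ.NonNegative value

open ℚ≥0 public using (value)

infix  4 _≤_ _<_
infixl 6 _+_

_≤_ _<_ : ℚ≥0 → ℚ≥0 → Set
p ≤ q = value p ℚ.≤ value q
p < q = value p ℚ.< value q

_+_ : ℚ≥0 → ℚ≥0 → ℚ≥0
mk≥0 p + mk≥0 q = mk≥0 (p ℚ.+ q) {{ℚₚ.nonNeg+nonNeg⇒nonNeg p q}}

0≥0 : ℚ≥0
0≥0 = mk≥0 0ℚ

0-least : ∀ q → 0≥0 ≤ q
0-least q@(mk≥0 p {{nn}}) = ℚₚ.≤-trans (lemma nn) ℚₚ.≤-refl
  where
  lemma : .(ℚ.NonNegative p) → 0ℚ ℚ.≤ p
  lemma nn = ℚₚ.nonNegative⁻¹ p {{nn}}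

<-dense : ∀ {p q} → p < q → ∃[ m ] p < m × m < q
<-dense {p} p<q with ℚₚ.<-dense p<q
... | m , p<m , m<q =
  mk≥0 m {{ℚ.nonNegative (ℚₚ.≤-trans (0-least p) (ℚₚ.<⇒≤ p<m))}} , p<m , m<q

-- [0,∞] as closed upper cuts: a value x is given by the set of rationals
-- q ≥ 0 with x ≤ q.  Classically x ↦ { q | x ≤ q } is an isomorphism from
-- the extended non-negative reals (with order, + and sup) onto these cuts;
-- ∞ is the empty cut.
record [0,∞] (ℓ : Level) : Set (lsuc ℓ) where
  infix 4 _≤ℚ_
  field
    _≤ℚ_   : ℚ≥0 → Set ℓ
    upper  : ∀ {q r} → q ≤ r → _≤ℚ_ q → _≤ℚ_ r
    closed : ∀ {q} → (∀ r → q < r → _≤ℚ_ r) → _≤ℚ_ q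

infix 4 _≤ℚ_ _≤∞_ _≈∞_

_≤ℚ_ : [0,∞] ℓ → ℚ≥0 → Set ℓ
_≤ℚ_ = [0,∞]._≤ℚ_

_≤∞_ _≈∞_ : [0,∞] ℓ → [0,∞] ℓ → Set ℓ
x ≤∞ y = ∀ q → y ≤ℚ q → x ≤ℚ q
x ≈∞ y = x ≤∞ y × y ≤∞ x

0∞ : [0,∞] ℓ
0∞ = record { _≤ℚ_ = λ _ → ⊤ ; upper = λ _ _ → tt ; closed = λ _ → tt }

infixl 6 _+∞_

_+∞_ : [0,∞] ℓ → [0,∞] ℓ → [0,∞] ℓ
x +∞ y = record
  { _≤ℚ_   = λ q → ∀ r → q < r → ∃[ a ] ∃[ b ] x ≤ℚ a × y ≤ℚ b × a + b ≤ r
  ; upper  = λ q≤q′ k r q′<r → k r (ℚₚ.≤-<-trans q≤q′ q′<r)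
  ; closed = λ {q} k r q<r →
      let m , q<m , m<r = <-dense {q} {r} q<r in k m q<m r m<r
  }

⨆ : ∀ {i} {I : Set i} → (I → [0,∞] ℓ) → [0,∞] (i ⊔ ℓ)
⨆ x = record
  { _≤ℚ_   = λ q → ∀ i → x i ≤ℚ q
  ; upper  = λ q≤r k i → [0,∞].upper (x i) q≤r (k i)
  ; closed = λ k i → [0,∞].closed (x i) (λ r q<r → k r q<r i)
  }

-- The carrier is a setoid, whose equality plays the role of = on points.
record MetricSpace (ℓ : Level) : Set (lsuc ℓ) where
  field
    setoid : Setoid ℓ ℓ
  open Setoid setoid public
    renaming (refl to ≈-refl; sym to ≈-sym; trans to ≈-trans)
  field
    d          : Carrier → Carrier → [0,∞] ℓ
    d≈0⇔≈      : ∀ {x y} → d x y ≈∞ 0∞ ⇔ x ≈ y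
    d-sym      : ∀ {x y} → d x y ≈∞ d y x
    d-triangle : ∀ {x y z} → d x y ≤∞ d x z +∞ d z y

  ≤0⇒≈ : ∀ {x y} → d x y ≤ℚ 0≥0 → x ≈ y
  ≤0⇒≈ p = Equivalence.to d≈0⇔≈
    ((λ q _ → [0,∞].upper (d _ _) (0-least q) p) , (λ _ _ → tt))

  ≈⇒≤ : ∀ {x y} q → x ≈ y → d x y ≤ℚ q
  ≈⇒≤ q x≈y = proj₁ (Equivalence.from d≈0⇔≈ x≈y) q tt

  d≤-trans : ∀ {x y z} {a b} → d x z ≤ℚ a → d z y ≤ℚ b → d x y ≤ℚ a + b
  d≤-trans p q = d-triangle _ (λ r lt → _ , _ , p , q , ℚₚ.<⇒≤ lt)

∣_∣ : MetricSpace ℓ → Set ℓ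
∣_∣ = MetricSpace.Carrier

record NonExpansive (X Y : MetricSpace ℓ) : Set ℓ where
  private
    module X = MetricSpace X
    module Y = MetricSpace Y
  field
    fun    : ∣ X ∣ → ∣ Y ∣
    nonexp : ∀ x y → Y.d (fun x) (fun y) ≤∞ X.d x y

  cong : ∀ {x y} → x X.≈ y → fun x Y.≈ fun y
  cong x≈y = Y.≤0⇒≈ (nonexp _ _ 0≥0 (X.≈⇒≤ 0≥0 x≈y))

open NonExpansive public using (fun; nonexp; cong)

idⁿ : {X : MetricSpace ℓ} → NonExpansive X X
idⁿ = record { fun = λ x → x ; nonexp = λ _ _ _ p → p }

_∘ⁿ_ : {X Y Z : MetricSpace ℓ} →
       NonExpansive Y Z → NonExpansive X Y → NonExpansive X Z
g ∘ⁿ f = record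
  { fun    = λ x → fun g (fun f x)
  ; nonexp = λ x y q p → nonexp g _ _ q (nonexp f x y q p)
  }

Met : (ℓ : Level) → Category (lsuc ℓ) ℓ ℓ
Met ℓ = record
  { Obj       = MetricSpace ℓ
  ; _⇒_       = NonExpansive
  ; _≈_       = λ {_} {Y} f g → ∀ x → MetricSpace._≈_ Y (fun f x) (fun g x)
  ; id        = idⁿ
  ; _∘_       = _∘ⁿ_
  ; equiv     = λ {_} {Y} → let open MetricSpace Y in record
      { refl  = λ _ → ≈-refl
      ; sym   = λ p x → ≈-sym (p x)
      ; trans = λ p q x → ≈-trans (p x) (q x)
      }
  ; ∘-resp-≈  = λ {_} {_} {Z} {f} p q x →
      MetricSpace.≈-trans Z (cong f (q x)) (p _)
  ; assoc     = λ {_} {_} {_} {Z} _ → MetricSpace.≈-refl Z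
  ; identityˡ = λ {_} {Y} _ → MetricSpace.≈-refl Y
  ; identityʳ = λ {_} {Y} _ → MetricSpace.≈-refl Y
  }

record Signature (ℓ : Level) : Set (lsuc ℓ) where
  field
    Op : Set ℓ
    ar : Op → ℕ

open Signature public

V : Set
V = ℕ

-- Arguments are functions on Fin, so terms with pointwise equal arguments need
-- not be ≡; every theory proves them =₀.
data Term {a} (Σ : Signature ℓ) (X : Set a) : Set (ℓ ⊔ a) where
  var : X → Term Σ X
  app : (f : Op Σ) → Vector (Term Σ X) (ar Σ f) → Term Σ X

fold : ∀ {a b} {Σ : Signature ℓ} {X : Set a} {A : Set b} →
       ((f : Op Σ) → Vector A (ar Σ f) → A) → (X → A) → Term Σ X → A
fold α ι (var x)    = ι x
fold α ι (app f ts) = α f (λ i → fold α ι (ts i))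

infix 8 _[_]ᵗ _[_]ᵉ

_[_]ᵗ : ∀ {a b} {Σ : Signature ℓ} {X : Set a} {Y : Set b} →
        Term Σ X → (X → Term Σ Y) → Term Σ Y
t [ σ ]ᵗ = fold app σ t

infix 4 _=[_]_
infix 3 _⊢_

record QEq (Σ : Signature ℓ) : Set ℓ where
  constructor _=[_]_
  field
    lhs : Term Σ V
    eps : ℚ≥0
    rhs : Term Σ V

-- The finite set of hypotheses is a list; by assum and cut, membership in a
-- theory depends only on the underlying set.
record CondQEq (Σ : Signature ℓ) : Set ℓ where
  constructor _⊢_
  field
    hyps  : List (QEq Σ)
    concl : QEq Σ

_[_]ᵉ : {Σ : Signature ℓ} → QEq Σ → (V → Term Σ V) → QEq Σ
(t =[ ε ] s) [ σ ]ᵉ = t [ σ ]ᵗ =[ ε ] s [ σ ]ᵗ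

record IsTheory (Σ : Signature ℓ) (U : Pred (CondQEq Σ) ℓ) : Set ℓ where
  field
    reflᵁ  : ∀ x → U ([] ⊢ var x =[ 0≥0 ] var x)
    symᵁ   : ∀ x y ε → U ([ var x =[ ε ] var y ] ⊢ var y =[ ε ] var x)
    triang : ∀ x y z ε ε′ →
             U ((var x =[ ε ] var z) ∷ (var z =[ ε′ ] var y) ∷ []
                ⊢ var x =[ ε + ε′ ] var y)
    max    : ∀ x y ε ε′ → 0≥0 < ε′ →
             U ([ var x =[ ε ] var y ] ⊢ var x =[ ε + ε′ ] var y)
    nexp   : ∀ f ε (xs ys : Vector V (ar Σ f)) →
             U (tabulate (λ i → var (xs i) =[ ε ] var (ys i))
                ⊢ app f (λ i → var (xs i)) =[ ε ] app f (λ i → var (ys i)))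
    cont   : ∀ {Γ t s ε} → (∀ ε′ → ε < ε′ → U (Γ ⊢ t =[ ε′ ] s)) →
             U (Γ ⊢ t =[ ε ] s)
    substᵁ : ∀ (σ : V → Term Σ V) {Γ φ} → U (Γ ⊢ φ) →
             U (map (_[ σ ]ᵉ) Γ ⊢ φ [ σ ]ᵉ)
    assum  : ∀ {Γ φ} → φ ∈ Γ → U (Γ ⊢ φ)
    cut    : ∀ {Γ Θ ψ} → (∀ {φ} → φ ∈ Θ → U (Γ ⊢ φ)) → U (Θ ⊢ ψ) → U (Γ ⊢ ψ)

record Theory (Σ : Signature ℓ) : Set (lsuc ℓ) where
  field
    members  : Pred (CondQEq Σ) ℓ
    isTheory : IsTheory Σ members

open Theory public

record Axiomatizes {Σ : Signature ℓ} (A : Pred (CondQEq Σ) ℓ) (𝒰 : Theory Σ)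
       : Set (lsuc ℓ) where
  field
    contains : A ⊆ members 𝒰
    least    : ∀ (𝒲 : Theory Σ) → A ⊆ members 𝒲 → members 𝒰 ⊆ members 𝒲

-- A basic theory is one with an axiomatization A whose hypotheses only
-- relate variables.
data IsVar {Σ : Signature ℓ} : Term Σ V → Set ℓ where
  isVar : ∀ x → IsVar (var x)

IsBasicCond : {Σ : Signature ℓ} → CondQEq Σ → Set ℓ
IsBasicCond (Γ ⊢ _) = All (λ (t =[ _ ] s) → IsVar t × IsVar s) Γ

Basic : {Σ : Signature ℓ} → Theory Σ → Set (lsuc ℓ)
Basic {ℓ} {Σ} 𝒰 =
  ∃[ A ] (∀ {c} → A c → IsBasicCond c) × Axiomatizes {ℓ} {Σ} A 𝒰

-- The smallest theory containing A; closure-axiomatized is its minimality.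
module _ {Σ : Signature ℓ} (A : Pred (CondQEq Σ) ℓ) where

  data Closure : CondQEq Σ → Set ℓ where
    axiom  : ∀ {c} → A c → Closure c
    reflᶜ  : ∀ x → Closure ([] ⊢ var x =[ 0≥0 ] var x)
    symᶜ   : ∀ x y ε → Closure ([ var x =[ ε ] var y ] ⊢ var y =[ ε ] var x)
    triang : ∀ x y z ε ε′ →
             Closure ((var x =[ ε ] var z) ∷ (var z =[ ε′ ] var y) ∷ []
                      ⊢ var x =[ ε + ε′ ] var y)
    max    : ∀ x y ε ε′ → 0≥0 < ε′ →
             Closure ([ var x =[ ε ] var y ] ⊢ var x =[ ε + ε′ ] var y)
    nexp   : ∀ f ε (xs ys : Vector V (ar Σ f)) →
             Closure (tabulate (λ i → var (xs i) =[ ε ] var (ys i))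
                      ⊢ app f (λ i → var (xs i)) =[ ε ] app f (λ i → var (ys i)))
    cont   : ∀ {Γ t s ε} → (∀ ε′ → ε < ε′ → Closure (Γ ⊢ t =[ ε′ ] s)) →
             Closure (Γ ⊢ t =[ ε ] s)
    substᶜ : ∀ (σ : V → Term Σ V) {Γ φ} → Closure (Γ ⊢ φ) →
             Closure (map (_[ σ ]ᵉ) Γ ⊢ φ [ σ ]ᵉ)
    assum  : ∀ {Γ φ} → φ ∈ Γ → Closure (Γ ⊢ φ)
    cut    : ∀ {Γ Θ ψ} → (∀ {φ} → φ ∈ Θ → Closure (Γ ⊢ φ)) →
             Closure (Θ ⊢ ψ) → Closure (Γ ⊢ ψ)

  closure : Theory Σ
  closure = record
    { members  = Closure
    ; isTheory = record
      { reflᵁ = reflᶜ ; symᵁ = symᶜ ; triang = triang ; max = max ; nexp = nexp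
      ; cont = cont ; substᵁ = substᶜ ; assum = assum ; cut = cut }
    }

  closure-axiomatized : Axiomatizes A closure
  closure-axiomatized = record { contains = axiom ; least = least }
    where
    least : ∀ (𝒲 : Theory Σ) → A ⊆ members 𝒲 → Closure ⊆ members 𝒲
    least 𝒲 A⊆𝒲 = go
      where
      module W = IsTheory (isTheory 𝒲)
      go : Closure ⊆ members 𝒲
      go (axiom a)             = A⊆𝒲 a
      go (reflᶜ x)             = W.reflᵁ x
      go (symᶜ x y ε)          = W.symᵁ x y ε
      go (triang x y z ε ε′)   = W.triang x y z ε ε′
      go (max x y ε ε′ 0<ε′)   = W.max x y ε ε′ 0<ε′
      go (nexp f ε xs ys)      = W.nexp f ε xs ys
      go (cont k)              = W.cont (λ ε′ lt → go (k ε′ lt))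
      go (substᶜ σ p)          = W.substᵁ σ (go p)
      go (assum φ∈Γ)           = W.assum φ∈Γ
      go (cut ps p)            = W.cut (λ φ∈Θ → go (ps φ∈Θ)) (go p)

-- For disjoint types, Σ ∪ Σ′ is the disjoint union; inlᵗ and inrᵗ below are
-- the inclusions of terms.
infixr 5 _⊎ˢ_

_⊎ˢ_ : Signature ℓ → Signature ℓ → Signature ℓ
Σ ⊎ˢ Σ′ = record { Op = Op Σ ⊎ Op Σ′ ; ar = [ ar Σ , ar Σ′ ]′ }

module _ {Σ Σ′ : Signature ℓ} where

  inlᵗ : Term Σ V → Term (Σ ⊎ˢ Σ′) V
  inlᵗ = fold (λ f → app (inj₁ f)) var

  inrᵗ : Term Σ′ V → Term (Σ ⊎ˢ Σ′) V
  inrᵗ = fold (λ g → app (inj₂ g)) var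

  inlᵉ : QEq Σ → QEq (Σ ⊎ˢ Σ′)
  inlᵉ (t =[ ε ] s) = inlᵗ t =[ ε ] inlᵗ s

  inrᵉ : QEq Σ′ → QEq (Σ ⊎ˢ Σ′)
  inrᵉ (t =[ ε ] s) = inrᵗ t =[ ε ] inrᵗ s

  data TensorAxiom (𝒰 : Theory Σ) (𝒰′ : Theory Σ′) : CondQEq (Σ ⊎ˢ Σ′) → Set ℓ where
    left  : ∀ {Γ φ} → members 𝒰 (Γ ⊢ φ) → TensorAxiom 𝒰 𝒰′ (map inlᵉ Γ ⊢ inlᵉ φ)
    right : ∀ {Γ φ} → members 𝒰′ (Γ ⊢ φ) → TensorAxiom 𝒰 𝒰′ (map inrᵉ Γ ⊢ inrᵉ φ)
    comm  : ∀ f g (x : Fin (ar Σ f) → Fin (ar Σ′ g) → V) →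
            TensorAxiom 𝒰 𝒰′
              ([] ⊢ app (inj₁ f) (λ i → app (inj₂ g) (λ j → var (x i j)))
                    =[ 0≥0 ]
                    app (inj₂ g) (λ j → app (inj₁ f) (λ i → var (x i j))))

  infixr 5 _⊗_
  _⊗_ : Theory Σ → Theory Σ′ → Theory (Σ ⊎ˢ Σ′)
  𝒰 ⊗ 𝒰′ = closure (TensorAxiom 𝒰 𝒰′)

ReaderSig : ℕ → Signature ℓ
ReaderSig n = record { Op = ⊤ ; ar = λ _ → n }

𝗋 : ∀ {n} → Vector (Term (ReaderSig {ℓ} n) V) n → Term (ReaderSig {ℓ} n) V
𝗋 = app tt

data ReaderAxiom {ℓ} (n : ℕ) : CondQEq (ReaderSig {ℓ} n) → Set ℓ where
  idem : ∀ x → ReaderAxiom n ([] ⊢ var x =[ 0≥0 ] 𝗋 (λ _ → var x))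
  diag : ∀ (x : Fin n → Fin n → V) →
         ReaderAxiom n ([] ⊢ 𝗋 (λ i → var (x i i))
                             =[ 0≥0 ] 𝗋 (λ i → 𝗋 (λ j → var (x i j))))

𝓡 : (n : ℕ) → Theory (ReaderSig {ℓ} n)
𝓡 n = closure (ReaderAxiom n)

record Algebra (Σ : Signature ℓ) : Set (lsuc ℓ) where
  field
    space : MetricSpace ℓ
  open MetricSpace space public
  field
    op        : (f : Op Σ) → Vector Carrier (ar Σ f) → Carrier
    op-nonexp : ∀ f as bs → d (op f as) (op f bs) ≤∞ ⨆ (λ i → d (as i) (bs i))

  ⟦_⟧ : ∀ {a} {X : Set a} → Term Σ X → (X → Carrier) → Carrier
  ⟦ t ⟧ ι = fold op ι t

  op-cong : ∀ f {as bs} → (∀ i → as i ≈ bs i) → op f as ≈ op f bs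
  op-cong f p = ≤0⇒≈ (op-nonexp f _ _ 0≥0 (λ i → ≈⇒≤ 0≥0 (p i)))

  infix 4 _⊨ᵉ_
  _⊨ᵉ_ : (V → Carrier) → QEq Σ → Set ℓ
  ι ⊨ᵉ (t =[ ε ] s) = d (⟦ t ⟧ ι) (⟦ s ⟧ ι) ≤ℚ ε

  Satisfies : CondQEq Σ → Set ℓ
  Satisfies (Γ ⊢ φ) = ∀ (ι : V → Carrier) → (∀ {ψ} → ψ ∈ Γ → ι ⊨ᵉ ψ) → ι ⊨ᵉ φ

record Model {Σ : Signature ℓ} (𝒰 : Theory Σ) : Set (lsuc ℓ) where
  field
    algebra : Algebra Σ
  open Algebra algebra public
  field
    satisfies : ∀ {c} → members 𝒰 c → Satisfies c

record Homomorphism {Σ : Signature ℓ} (A B : Algebra Σ) : Set ℓ where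
  private
    module A = Algebra A
    module B = Algebra B
  field
    map₁ : NonExpansive A.space B.space
    homo : ∀ f as → fun map₁ (A.op f as) B.≈ B.op f (λ i → fun map₁ (as i))

open Homomorphism public using (map₁; homo)

𝕂 : (Σ : Signature ℓ) → Theory Σ → Category (lsuc ℓ) ℓ ℓ
𝕂 {ℓ} Σ 𝒰 = record
  { Obj       = Model 𝒰
  ; _⇒_       = λ A B → Homomorphism (Model.algebra A) (Model.algebra B)
  ; _≈_       = λ {A} {B} f g →
      Category._≈_ (Met ℓ) {Model.space A} {Model.space B} (map₁ f) (map₁ g)
  ; id        = λ {A} → record { map₁ = idⁿ ; homo = λ _ _ → Model.≈-refl A }
  ; _∘_       = λ {A} {B} {C} g f → record
      { map₁ = map₁ g ∘ⁿ map₁ f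
      ; homo = λ k as →
          Model.≈-trans C (cong (map₁ g) (homo f k as)) (homo g k _)
      }
  ; equiv     = λ {_} {B} → let open Model B in record
      { refl  = λ _ → ≈-refl
      ; sym   = λ p x → ≈-sym (p x)
      ; trans = λ p q x → ≈-trans (p x) (q x)
      }
  ; ∘-resp-≈  = λ {_} {_} {C} {f} p q x →
      Model.≈-trans C (cong (map₁ f) (q x)) (p _)
  ; assoc     = λ {_} {_} {_} {D} _ → Model.≈-refl D
  ; identityˡ = λ {_} {B} _ → Model.≈-refl B
  ; identityʳ = λ {_} {B} _ → Model.≈-refl B
  }

Forget : {Σ : Signature ℓ} (𝒰 : Theory Σ) → Functor (𝕂 Σ 𝒰) (Met ℓ)
Forget 𝒰 = record
  { F₀           = Model.space
  ; F₁           = map₁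
  ; F-resp-≈     = λ p → p
  ; identity     = λ {A} _ → Model.≈-refl A
  ; homomorphism = λ {_} {_} {C} _ → Model.≈-refl C
  }

-- The left adjoint of the forgetful functor: terms over X, at distance ≤ ε
-- when this is derivable from 𝒰 and the distances of X.
module Free {Σ : Signature ℓ} (𝒰 : Theory Σ) where

  module _ (X : MetricSpace ℓ) where
    private module X = MetricSpace X

    infix 4 _~[_]_
    data _~[_]_ : Term Σ ∣ X ∣ → ℚ≥0 → Term Σ ∣ X ∣ → Set ℓ where
      gen      : ∀ {x y ε} → X.d x y ≤ℚ ε → var x ~[ ε ] var y
      ~refl    : ∀ {t} → t ~[ 0≥0 ] t
      ~sym     : ∀ {t s ε} → t ~[ ε ] s → s ~[ ε ] t
      ~trans   : ∀ {t u s ε ε′} → t ~[ ε ] u → u ~[ ε′ ] s → t ~[ ε + ε′ ] s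
      ~upper   : ∀ {t s ε ε′} → ε ≤ ε′ → t ~[ ε ] s → t ~[ ε′ ] s
      ~closed  : ∀ {t s ε} → (∀ ε′ → ε < ε′ → t ~[ ε′ ] s) → t ~[ ε ] s
      ~nexp    : ∀ {f ts ss ε} → (∀ i → ts i ~[ ε ] ss i) →
                 app f ts ~[ ε ] app f ss
      ~theory  : ∀ {Γ t ε s} → members 𝒰 (Γ ⊢ t =[ ε ] s) →
                 (σ : V → Term Σ ∣ X ∣) →
                 (∀ {t′ ε′ s′} → (t′ =[ ε′ ] s′) ∈ Γ →
                    t′ [ σ ]ᵗ ~[ ε′ ] s′ [ σ ]ᵗ) →
                 t [ σ ]ᵗ ~[ ε ] s [ σ ]ᵗ

    private
      ~0-trans : ∀ {t u s} → t ~[ 0≥0 ] u → u ~[ 0≥0 ] s → t ~[ 0≥0 ] s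
      ~0-trans p q = ~upper (ℚₚ.≤-reflexive (ℚₚ.+-identityˡ 0ℚ)) (~trans p q)

    freeSpace : MetricSpace ℓ
    freeSpace = record
      { setoid     = record
        { Carrier       = Term Σ ∣ X ∣
        ; _≈_           = λ t s → t ~[ 0≥0 ] s
        ; isEquivalence = record { refl = ~refl ; sym = ~sym ; trans = ~0-trans }
        }
      ; d          = λ t s → record
        { _≤ℚ_ = λ ε → t ~[ ε ] s ; upper = ~upper ; closed = ~closed }
      ; d≈0⇔≈      = mk⇔ (λ (p , _) → p 0≥0 tt)
                         (λ p → (λ q _ → ~upper {ε′ = q} (0-least q) p) , (λ _ _ → tt))
      ; d-sym      = (λ _ → ~sym) , (λ _ → ~sym)
      ; d-triangle = λ q k → ~closed λ r q<r →
          let _ , _ , p , p′ , a+b≤r = k r q<r in ~upper a+b≤r (~trans p p′)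
      }

    freeModel : Model 𝒰
    freeModel = record
      { algebra   = record
        { space     = freeSpace
        ; op        = app
        ; op-nonexp = λ _ _ _ _ → ~nexp
        }
      ; satisfies = λ c∈𝒰 ι hyp → ~theory c∈𝒰 ι (λ ψ∈Γ → hyp ψ∈Γ)
      }

  module _ {X : MetricSpace ℓ} (A : Model 𝒰) (h : NonExpansive X (Model.space A)) where
    private
      module A = Model A

    eval : Term Σ ∣ X ∣ → A.Carrier
    eval t = A.⟦ t ⟧ (fun h)

    eval-subst : ∀ (σ : V → Term Σ ∣ X ∣) t →
                 eval (t [ σ ]ᵗ) A.≈ A.⟦ t ⟧ (λ v → eval (σ v))
    eval-subst σ (var v)    = A.≈-refl
    eval-subst σ (app f ts) = A.op-cong f (λ i → eval-subst σ (ts i))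

    private
      shift : ∀ {a a′ b b′ q} → a A.≈ a′ → b A.≈ b′ →
              A.d a b ≤ℚ q → A.d a′ b′ ≤ℚ q
      shift {q = q} a≈a′ b≈b′ p = [0,∞].upper (A.d _ _)
        (ℚₚ.≤-reflexive (ℚₚ.+-identityʳ (value q)))
        (A.d≤-trans {b = 0≥0}
          ([0,∞].upper (A.d _ _) {r = q} (ℚₚ.≤-reflexive (ℚₚ.+-identityˡ (value q)))
            (A.d≤-trans {a = 0≥0} (A.≈⇒≤ 0≥0 (A.≈-sym a≈a′)) p))
          (A.≈⇒≤ 0≥0 b≈b′))

    eval-nonexp : ∀ {t s ε} → _~[_]_ X t ε s → A.d (eval t) (eval s) ≤ℚ ε
    eval-nonexp (gen p)        = nonexp h _ _ _ p
    eval-nonexp ~refl          = A.≈⇒≤ 0≥0 A.≈-refl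
    eval-nonexp (~sym p)       = proj₂ A.d-sym _ (eval-nonexp p)
    eval-nonexp (~trans p q)   = A.d≤-trans (eval-nonexp p) (eval-nonexp q)
    eval-nonexp (~upper le p)  = [0,∞].upper (A.d _ _) le (eval-nonexp p)
    eval-nonexp (~closed k)    = [0,∞].closed (A.d _ _) (λ r lt → eval-nonexp (k r lt))
    eval-nonexp (~nexp {f} ps) = A.op-nonexp f _ _ _ (λ i → eval-nonexp (ps i))
    eval-nonexp (~theory {t = t} {s = s} c∈𝒰 σ hyp) =
      shift (A.≈-sym (eval-subst σ t)) (A.≈-sym (eval-subst σ s))
        (A.satisfies c∈𝒰 (λ v → eval (σ v)) λ { {t′ =[ _ ] s′} ψ∈Γ →
          shift (eval-subst σ t′) (eval-subst σ s′) (eval-nonexp (hyp ψ∈Γ)) })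

    extend : Homomorphism (Model.algebra (freeModel X)) A.algebra
    extend = record
      { map₁ = record { fun = eval ; nonexp = λ _ _ _ → eval-nonexp }
      ; homo = λ _ _ → A.≈-refl
      }

  unitᶠ : (X : MetricSpace ℓ) → NonExpansive X (freeSpace X)
  unitᶠ X = record { fun = var ; nonexp = λ _ _ _ → gen }

  ext : ∀ {X} (A : Model 𝒰) (let module A = Model A)
        (f g : Homomorphism (Model.algebra (freeModel X)) A.algebra) →
        (∀ x → fun (map₁ f) (var x) A.≈ fun (map₁ g) (var x)) →
        ∀ t → fun (map₁ f) t A.≈ fun (map₁ g) t
  ext A f g p (var x)    = p x
  ext A f g p (app k ts) = A.≈-trans (homo f k ts)
    (A.≈-trans (A.op-cong k (λ i → ext A f g p (ts i))) (A.≈-sym (homo g k ts)))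
    where module A = Model A

  leftAdjoint : LeftAdjoint (Forget 𝒰)
  leftAdjoint = record
    { F = record
      { F₀           = freeModel
      ; F₁           = free₁
      ; F-resp-≈     = λ {X} {Y} {f} {g} p →
          ext (freeModel Y) (free₁ f) (free₁ g)
            (λ x → gen (MetricSpace.≈⇒≤ Y 0≥0 (p x)))
      ; identity     = λ {X} → ext (freeModel X) (free₁ idⁿ) (K.id {freeModel X}) (λ _ → ~refl)
      ; homomorphism = λ {X} {Y} {Z} {f} {g} →
          ext (freeModel Z) (free₁ (g ∘ⁿ f))
            (K._∘_ {freeModel X} {freeModel Y} {freeModel Z} (free₁ g) (free₁ f))
            (λ _ → ~refl)
      }
    ; unit           = unitᶠ
    ; counit         = counitᶠ
    ; unit-natural   = λ _ _ → ~refl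
    ; counit-natural = λ {A} {B} f →
        let FA = freeModel (Model.space A) ; FB = freeModel (Model.space B) in
        ext B (K._∘_ {FA} {FB} {B} (counitᶠ B) (free₁ (map₁ f)))
              (K._∘_ {FA} {A} {B} f (counitᶠ A))
              (λ _ → Model.≈-refl B)
    ; zig            = λ {X} →
        let FX = freeModel X ; FFX = freeModel (freeSpace X) in
        ext FX (K._∘_ {FX} {FFX} {FX} (counitᶠ FX) (free₁ (unitᶠ X))) (K.id {FX})
          (λ _ → ~refl)
    ; zag            = λ {A} _ → Model.≈-refl A
    }
    where
    module K = Category (𝕂 Σ 𝒰)
    free₁ : ∀ {X Y} → NonExpansive X Y → freeModel X K.⇒ freeModel Y
    free₁ {X} {Y} f = extend (freeModel Y) (unitᶠ Y ∘ⁿ f)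
    counitᶠ : ∀ A → freeModel (Model.space A) K.⇒ A
    counitᶠ A = extend A idⁿ

freeMonad : {Σ : Signature ℓ} → Theory Σ → Monad (Met ℓ)
freeMonad 𝒰 = inducedMonad (Free.leftAdjoint 𝒰)

_^_ : MetricSpace ℓ → Set ℓ → MetricSpace ℓ
X ^ E = record
  { setoid     = record
    { Carrier       = E → X.Carrier
    ; _≈_           = λ f g → ∀ e → f e X.≈ g e
    ; isEquivalence = record
      { refl  = λ _ → X.≈-refl
      ; sym   = λ p e → X.≈-sym (p e)
      ; trans = λ p q e → X.≈-trans (p e) (q e)
      }
    }
  ; d          = λ f g → ⨆ (λ e → X.d (f e) (g e))
  ; d≈0⇔≈      = mk⇔ (λ (p , _) e → X.≤0⇒≈ (p 0≥0 tt e))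
                     (λ p → (λ q _ e → X.≈⇒≤ q (p e)) , (λ _ _ → tt))
  ; d-sym      = (λ q k e → proj₁ X.d-sym q (k e)) , (λ q k e → proj₂ X.d-sym q (k e))
  ; d-triangle = λ q k e → X.d-triangle q λ r q<r →
      let a , b , p , p′ , le = k r q<r in a , b , p e , p′ e , le
  }
  where module X = MetricSpace X

ev : {X : MetricSpace ℓ} {E : Set ℓ} → E → NonExpansive (X ^ E) X
ev e = record { fun = λ g → g e ; nonexp = λ _ _ _ p → p e }

readerComposite : Monad (Met ℓ) → Set ℓ → Monad (Met ℓ)
readerComposite {ℓ} T E = record
  { functor = record
    { F₀           = M₀
    ; F₁           = M₁
    ; F-resp-≈     = λ p g e → T.F-resp-≈ p (g e)
    ; identity     = λ g e → T.identity (g e)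
    ; homomorphism = λ g e → T.homomorphism (g e)
    }
  ; η         = λ X → record
    { fun    = λ x _ → fun (T.η X) x
    ; nonexp = λ x y q p _ → nonexp (T.η X) x y q p
    }
  ; μ         = Mμ
  ; η-natural = λ f x _ → T.η-natural f x
  ; μ-natural = λ {X} {Y} f g e → let open Eq (T.F₀ Y) in
      trans (cong (T.μ Y) (push (ev e) (M₁ f) (ev e) (T.F₁ f)
                              (λ _ → MetricSpace.≈-refl (T.F₀ Y)) (g e)))
            (T.μ-natural f _)
  ; μ-assoc   = λ {X} g e → let open Eq (T.F₀ X) in
      trans (cong (T.μ X)
              (push (ev e) (Mμ X) (T.F₁ (ev e) ∘ⁿ ev e) (T.μ X)
                 (λ _ → MetricSpace.≈-refl (T.F₀ X)) (g e)))
      (trans (T.μ-assoc _)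
             (cong (T.μ X)
               (Eq.trans (T.F₀ (T.F₀ X))
                      (cong (T.μ (T.F₀ X)) (T.homomorphism (g e)))
                      (T.μ-natural (ev e) _))))
  ; unitˡ     = λ {X} g e → let open Eq (T.F₀ X) in
      trans (cong (T.μ X) (Eq.sym (T.F₀ (T.F₀ X)) (T.homomorphism (g e))))
            (T.unitˡ (g e))
  ; unitʳ     = λ {X} g e → let open Eq (T.F₀ X) in
      trans (cong (T.μ X) (Eq.sym (T.F₀ (T.F₀ X)) (T.η-natural (ev e) g)))
            (T.unitʳ (g e))
  }
  where
  module T = Monad T
  module Eq (X : MetricSpace ℓ) = MetricSpace X
    using () renaming (≈-trans to trans; ≈-sym to sym)

  M₀ : MetricSpace ℓ → MetricSpace ℓ
  M₀ X = T.F₀ X ^ E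

  M₁ : ∀ {X Y} → NonExpansive X Y → NonExpansive (M₀ X) (M₀ Y)
  M₁ f = record
    { fun    = λ g e → fun (T.F₁ f) (g e)
    ; nonexp = λ _ _ q p e → nonexp (T.F₁ f) _ _ q (p e)
    }

  Mμ : ∀ X → NonExpansive (M₀ (M₀ X)) (M₀ X)
  Mμ X = record
    { fun    = λ g e → fun (T.μ X) (fun (T.F₁ (ev e)) (g e))
    ; nonexp = λ _ _ q p e →
        nonexp (T.μ X) _ _ q (nonexp (T.F₁ (ev e)) _ _ q (p e))
    }

  push : ∀ {A B C D} (g : NonExpansive B D) (f : NonExpansive A B)
         (k : NonExpansive A C) (l : NonExpansive C D) →
         Category._≈_ (Met ℓ) {A} {D} (g ∘ⁿ f) (l ∘ⁿ k) →
         ∀ t → MetricSpace._≈_ (T.F₀ D) (fun (T.F₁ g) (fun (T.F₁ f) t))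
                                         (fun (T.F₁ l) (fun (T.F₁ k) t))
  push {D = D} g f k l p t = trans (sym (T.homomorphism t))
    (trans (T.F-resp-≈ p t) (T.homomorphism t))
    where open Eq (T.F₀ D)

{-# OPTIONS --safe #-}

-- Products of 𝒰-models are 𝒰-models, and X ^ E carries the reader operation
-- r(g₁,…,gₙ)(eᵢ) = gᵢ(eᵢ), which commutes with every pointwise operation.  So
-- (T_𝒰 X) ^ E is a model of 𝒰 ⊗ 𝓡, and folding gives a map out of T_{𝒰⊗𝓡} X.
-- Its inverse is g ↦ r(g(e₁),…,g(eₙ)): the tensor equations push r inside the
-- operations of Σ, diagonality absorbs nested occurrences of r, and idempotence
-- treats the generators.  The same three laws show that it is a monad morphism.
module Submission where

open import Level using (Level)
open import Data.Nat.Base using (ℕ; zero; suc)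
open import Data.Fin.Base using (Fin; zero; suc; toℕ; combine; remQuot)
open import Data.Fin.Properties using (remQuot-combine)
open import Data.Product.Base using (_,_; proj₁; uncurry)
open import Data.Sum.Base using (inj₁; inj₂)
open import Data.Unit.Polymorphic.Base using (tt)
open import Data.List.Base using (map)
open import Data.List.Membership.Propositional.Properties
  using (∈-map⁺; ∈-map⁻; ∈-tabulate⁺)
open import Data.List.Relation.Unary.Any using (here; there)
open import Data.Vec.Functional using (Vector)
import Data.Rational.Properties as ℚₚ
open import Function.Bundles using (_↔_; Inverse; _⇔_; mk⇔; Equivalence)
open import Relation.Binary.PropositionalEquality as ≡ using (_≡_; refl)
open import Relation.Unary using (Pred)
open import Defs

private
  variable
    ℓ a : Level

-- Transport along equality of points; inverses of monad morphisms

MetricSpace-≡⇒≈ : (X : MetricSpace ℓ) → ∀ {x y} → x ≡ y → MetricSpace._≈_ X x y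
MetricSpace-≡⇒≈ X refl = MetricSpace.≈-refl X

-- Equal points are at distance zero, so two triangle inequalities suffice; `upper` absorbs the
-- added zeros.
d-resp-≈ : (X : MetricSpace ℓ) (let open MetricSpace X) → ∀ {x x′ y y′ q} →
           x ≈ x′ → y ≈ y′ → d x y ≤ℚ q → d x′ y′ ≤ℚ q
d-resp-≈ X {q = q} x≈x′ y≈y′ p =
  [0,∞].upper (d _ _) (ℚₚ.≤-reflexive (ℚₚ.+-identityʳ (value q)))
    (d≤-trans {b = 0≥0}
      ([0,∞].upper (d _ _) {r = q} (ℚₚ.≤-reflexive (ℚₚ.+-identityˡ (value q)))
        (d≤-trans {a = 0≥0} (≈⇒≤ 0≥0 (≈-sym x≈x′)) p))
      (≈⇒≤ 0≥0 y≈y′))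
  where open MetricSpace X

module _ {S T : Monad (Met ℓ)} (φ : MonadMorphism S T) where
  private
    module S = Monad S
    module T = Monad T
  open MonadMorphism φ
  open Category (Met ℓ) using (_≈_)

  -- Each law for `τ` is the corresponding law for `σ` with `τ` applied and cancelled, so the monad
  -- laws have to be computed in one direction only.
  invertibleMorphism⇒iso :
    (τ : ∀ X → NonExpansive (T.F₀ X) (S.F₀ X)) →
    (∀ {X} → _≈_ {S.F₀ X} {S.F₀ X} (τ X ∘ⁿ σ X) idⁿ) →
    (∀ {X} → _≈_ {T.F₀ X} {T.F₀ X} (σ X ∘ⁿ τ X) idⁿ) →
    MonadIso S T
  invertibleMorphism⇒iso τ τσ≈id στ≈id = record
    { to   = φ
    ; from = record
      { σ       = τ
      ; natural = λ {X} {Y} f x → let open MetricSpace (S.F₀ Y) in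
          ≈-trans (cong (τ Y) (MetricSpace.≈-trans (T.F₀ Y)
                    (cong (T.F₁ f) (MetricSpace.≈-sym (T.F₀ X) (στ≈id x)))
                    (MetricSpace.≈-sym (T.F₀ Y) (natural f (fun (τ X) x)))))
                  (τσ≈id _)
      ; unit    = λ {X} x → let open MetricSpace (S.F₀ X) in
          ≈-trans (cong (τ X) (MetricSpace.≈-sym (T.F₀ X) (unit x))) (τσ≈id _)
      ; mult    = λ {X} x → let open MetricSpace (S.F₀ X) in
          ≈-trans (cong (τ X) (MetricSpace.≈-trans (T.F₀ X)
                    (cong (T.μ X) (MetricSpace.≈-sym (T.F₀ (T.F₀ X)) (section x)))
                    (MetricSpace.≈-sym (T.F₀ X) (mult _))))
                  (τσ≈id _)
      }
    ; isoˡ = τσ≈id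
    ; isoʳ = στ≈id
    }
    where
    -- Naturality moves the outer `σ` next to `τ (S.F₀ X)`; functoriality of `T` then lets the
    -- remaining pair cancel.
    section : ∀ {X} (x : ∣ T.F₀ (T.F₀ X) ∣) →
              MetricSpace._≈_ (T.F₀ (T.F₀ X))
                (fun (σ (T.F₀ X)) (fun (S.F₁ (σ X))
                  (fun (τ (S.F₀ X)) (fun (T.F₁ (τ X)) x))))
                x
    section {X} x =
      ≈-trans (natural (σ X) _)
      (≈-trans (cong (T.F₁ (σ X)) (στ≈id _))
      (≈-trans (≈-sym (T.homomorphism x))
      (≈-trans (T.F-resp-≈ στ≈id x) (T.identity x))))
      where open MetricSpace (T.F₀ (T.F₀ X))

-- Satisfaction is closed under the rules

module _ {Σ : Signature ℓ} (A : Algebra Σ) where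
  open Algebra A

  ⟦⟧-subst : ∀ (ι : V → Carrier) σ (t : Term Σ V) →
             ⟦ t [ σ ]ᵗ ⟧ ι ≈ ⟦ t ⟧ (λ v → ⟦ σ v ⟧ ι)
  ⟦⟧-subst ι σ (var v)    = ≈-refl
  ⟦⟧-subst ι σ (app f ts) = op-cong f (λ i → ⟦⟧-subst ι σ (ts i))

  ⊨ᵉ-subst : ∀ (ι : V → Carrier) σ ψ →
             (λ v → ⟦ σ v ⟧ ι) ⊨ᵉ ψ ⇔ ι ⊨ᵉ ψ [ σ ]ᵉ
  ⊨ᵉ-subst ι σ (t =[ _ ] s) = mk⇔
    (d-resp-≈ space (≈-sym (⟦⟧-subst ι σ t)) (≈-sym (⟦⟧-subst ι σ s)))
    (d-resp-≈ space (⟦⟧-subst ι σ t) (⟦⟧-subst ι σ s))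

  -- Since the conditional equations satisfied by `A` form a theory, minimality of `closure` reduces
  -- soundness to the axioms.
  theoryOf : Theory Σ
  theoryOf = record
    { members  = Satisfies
    ; isTheory = record
      { reflᵁ  = λ _ _ _ → ≈⇒≤ 0≥0 ≈-refl
      ; symᵁ   = λ _ _ _ _ hyp → proj₁ d-sym _ (hyp (here refl))
      ; triang = λ _ _ _ _ _ _ hyp → d≤-trans (hyp (here refl)) (hyp (there (here refl)))
      ; max    = λ _ _ ε ε′ 0<ε′ _ hyp → [0,∞].upper (d _ _)
          (ℚₚ.≤-trans (ℚₚ.≤-reflexive (≡.sym (ℚₚ.+-identityʳ (value ε))))
                      (ℚₚ.+-monoʳ-≤ (value ε) (ℚₚ.<⇒≤ 0<ε′)))
          (hyp (here refl))
      ; nexp   = λ f _ _ _ _ hyp → op-nonexp f _ _ _ (λ i → hyp (∈-tabulate⁺ i))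
      ; cont   = λ k ι hyp → [0,∞].closed (d _ _) (λ ε′ lt → k ε′ lt ι hyp)
      ; substᵁ = λ σ {Γ} {φ} sat ι hyp → Equivalence.to (⊨ᵉ-subst ι σ φ)
          (sat _ (λ {ψ} ψ∈Γ → Equivalence.from (⊨ᵉ-subst ι σ ψ)
            (hyp {ψ [ σ ]ᵉ} (∈-map⁺ (_[ σ ]ᵉ) ψ∈Γ))))
      ; assum  = λ φ∈Γ _ hyp → hyp φ∈Γ
      ; cut    = λ sats sat ι hyp → sat ι (λ φ∈Θ → sats φ∈Θ ι hyp)
      }
    }

  closureModel : (Ax : Pred (CondQEq Σ) ℓ) → (∀ {c} → Ax c → Satisfies c) →
                 Model (closure Ax)
  closureModel Ax sat = record
    { algebra   = A
    ; satisfies = Axiomatizes.least (closure-axiomatized Ax) theoryOf sat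
    }

-- Axioms mention only variables from V; a finite family of points is named by
-- an initial segment of V, the remaining variables denoting a default point.
assign : ∀ {A : Set a} {k} → A → Vector A k → V → A
assign {k = zero}  z as v       = z
assign {k = suc _} z as zero    = as zero
assign {k = suc _} z as (suc v) = assign z (λ i → as (suc i)) v

assign-toℕ : ∀ {A : Set a} {k} (z : A) (as : Vector A k) i → assign z as (toℕ i) ≡ as i
assign-toℕ z as zero    = refl
assign-toℕ z as (suc i) = assign-toℕ z (λ j → as (suc j)) i

-- A matrix of pairwise distinct variables, so that one instance of an axiom can be read at any
-- matrix of points.
cell : ∀ {m n} → Fin m → Fin n → V
cell i j = toℕ (combine i j)

assign₂ : ∀ {A : Set a} {m n} → A → (Fin m → Fin n → A) → V → A
assign₂ {n = n} z as = assign z (λ k → uncurry as (remQuot n k))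

assign₂-cell : ∀ {A : Set a} {m n} (z : A) (as : Fin m → Fin n → A) i j →
               assign₂ z as (cell i j) ≡ as i j
assign₂-cell z as i j =
  ≡.trans (assign-toℕ z _ (combine i j)) (≡.cong (uncurry as) (remQuot-combine i j))

-- Reducts and models of the tensor

module _ {Σ Σ′ : Signature ℓ} (A : Algebra (Σ ⊎ˢ Σ′)) where
  open Algebra A

  reductˡ : Algebra Σ
  reductˡ = record
    { space     = space
    ; op        = λ f → op (inj₁ f)
    ; op-nonexp = λ f → op-nonexp (inj₁ f)
    }

  reductʳ : Algebra Σ′
  reductʳ = record
    { space     = space
    ; op        = λ g → op (inj₂ g)
    ; op-nonexp = λ g → op-nonexp (inj₂ g)
    }

  private
    module L = Algebra reductˡ
    module R = Algebra reductʳ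

  ⟦⟧-inlᵗ : ∀ ι t → ⟦ inlᵗ t ⟧ ι ≈ L.⟦ t ⟧ ι
  ⟦⟧-inlᵗ ι (var v)    = ≈-refl
  ⟦⟧-inlᵗ ι (app f ts) = op-cong (inj₁ f) (λ i → ⟦⟧-inlᵗ ι (ts i))

  ⟦⟧-inrᵗ : ∀ ι t → ⟦ inrᵗ t ⟧ ι ≈ R.⟦ t ⟧ ι
  ⟦⟧-inrᵗ ι (var v)    = ≈-refl
  ⟦⟧-inrᵗ ι (app g ts) = op-cong (inj₂ g) (λ i → ⟦⟧-inrᵗ ι (ts i))

  ⊨ᵉ-inlᵉ : ∀ ι ψ → ι L.⊨ᵉ ψ ⇔ ι ⊨ᵉ inlᵉ ψ
  ⊨ᵉ-inlᵉ ι (t =[ _ ] s) = mk⇔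
    (d-resp-≈ space (≈-sym (⟦⟧-inlᵗ ι t)) (≈-sym (⟦⟧-inlᵗ ι s)))
    (d-resp-≈ space (⟦⟧-inlᵗ ι t) (⟦⟧-inlᵗ ι s))

  ⊨ᵉ-inrᵉ : ∀ ι ψ → ι R.⊨ᵉ ψ ⇔ ι ⊨ᵉ inrᵉ ψ
  ⊨ᵉ-inrᵉ ι (t =[ _ ] s) = mk⇔
    (d-resp-≈ space (≈-sym (⟦⟧-inrᵗ ι t)) (≈-sym (⟦⟧-inrᵗ ι s)))
    (d-resp-≈ space (⟦⟧-inrᵗ ι t) (⟦⟧-inrᵗ ι s))

  satisfies-inlᵉ : ∀ {Γ φ} → L.Satisfies (Γ ⊢ φ) → Satisfies (map inlᵉ Γ ⊢ inlᵉ φ)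
  satisfies-inlᵉ {Γ} {φ} sat ι hyp = Equivalence.to (⊨ᵉ-inlᵉ ι φ)
    (sat ι (λ {ψ} ψ∈Γ → Equivalence.from (⊨ᵉ-inlᵉ ι ψ) (hyp {inlᵉ ψ} (∈-map⁺ inlᵉ ψ∈Γ))))

  satisfies-inlᵉ⁻ : ∀ {Γ φ} → Satisfies (map inlᵉ Γ ⊢ inlᵉ φ) → L.Satisfies (Γ ⊢ φ)
  satisfies-inlᵉ⁻ {Γ} {φ} sat ι hyp = Equivalence.from (⊨ᵉ-inlᵉ ι φ)
    -- A member of `map inlᵉ Γ` is only propositionally equal to some `inlᵉ χ`, hence the transport.
    (sat ι (λ ψ∈Γ → let χ , χ∈Γ , ψ≡ = ∈-map⁻ inlᵉ ψ∈Γ in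
      ≡.subst (ι ⊨ᵉ_) (≡.sym ψ≡) (Equivalence.to (⊨ᵉ-inlᵉ ι χ) (hyp {χ} χ∈Γ))))

  satisfies-inrᵉ : ∀ {Γ φ} → R.Satisfies (Γ ⊢ φ) → Satisfies (map inrᵉ Γ ⊢ inrᵉ φ)
  satisfies-inrᵉ {Γ} {φ} sat ι hyp = Equivalence.to (⊨ᵉ-inrᵉ ι φ)
    (sat ι (λ {ψ} ψ∈Γ → Equivalence.from (⊨ᵉ-inrᵉ ι ψ) (hyp {inrᵉ ψ} (∈-map⁺ inrᵉ ψ∈Γ))))

  -- Equivalently, every operation of `Σ′` is a homomorphism for the operations of `Σ`.
  Commuting : Set ℓ
  Commuting = ∀ f g (as : Fin (ar Σ f) → Fin (ar Σ′ g) → Carrier) →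
    op (inj₁ f) (λ i → op (inj₂ g) (λ j → as i j)) ≈
    op (inj₂ g) (λ j → op (inj₁ f) (λ i → as i j))

  tensorModel : {𝒰 : Theory Σ} {𝒰′ : Theory Σ′} →
    (∀ {c} → members 𝒰 c → L.Satisfies c) →
    (∀ {c} → members 𝒰′ c → R.Satisfies c) →
    Commuting → Model (𝒰 ⊗ 𝒰′)
  tensorModel {𝒰} {𝒰′} satˡ satʳ commuting = closureModel A (TensorAxiom 𝒰 𝒰′) λ
    { (left {Γ} {φ} c∈𝒰)   → satisfies-inlᵉ {Γ} {φ} (satˡ c∈𝒰)
    ; (right {Γ} {φ} c∈𝒰′) → satisfies-inrᵉ {Γ} {φ} (satʳ c∈𝒰′)
    ; (comm f g x)         → λ ι _ → ≈⇒≤ 0≥0 (commuting f g (λ i j → ι (x i j)))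
    }

module _ {Σ Σ′ : Signature ℓ} {𝒰 : Theory Σ} {𝒰′ : Theory Σ′} (A : Model (𝒰 ⊗ 𝒰′)) where
  open Model A

  modelˡ : Model 𝒰
  modelˡ = record
    { algebra   = reductˡ algebra
    ; satisfies = λ { {Γ ⊢ φ} c∈𝒰 →
        satisfies-inlᵉ⁻ algebra {Γ} {φ} (satisfies (axiom (left c∈𝒰))) }
    }

  model-commuting : Commuting algebra
  model-commuting f g as =
    ≈-trans (op-cong (inj₁ f) λ i → op-cong (inj₂ g) λ j → ≈-sym (named i j))
    (≈-trans (≤0⇒≈ (satisfies (axiom (comm f g cell)) ι (λ ())))
             (op-cong (inj₂ g) λ j → op-cong (inj₁ f) λ i → named i j))
    where
    ι : V → Carrier
    -- The matrix may be empty, so the default point is taken to be one side of the equation, which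
    -- exists for all arities.
    ι = assign₂ (op (inj₁ f) (λ i → op (inj₂ g) (as i))) as
    named : ∀ i j → ι (cell i j) ≈ as i j
    named i j = MetricSpace-≡⇒≈ space (assign₂-cell _ as i j)

-- The reader laws in a model of the tensor

module _ {Σ : Signature ℓ} {𝒰 : Theory Σ} {n : ℕ} (A : Model (𝒰 ⊗ 𝓡 n)) where
  open Model A

  read : Vector Carrier n → Carrier
  read = op (inj₂ tt)

  read-const : ∀ x → read (λ _ → x) ≈ x
  read-const x =
    ≈-sym (≤0⇒≈ (satisfies (axiom (right (axiom (idem 0)))) (λ _ → x) (λ ())))

  read-diag : ∀ (as : Fin n → Fin n → Carrier) →
              read (λ i → read (λ j → as i j)) ≈ read (λ i → as i i)
  read-diag as =
    ≈-trans (op-cong (inj₂ tt) λ i → op-cong (inj₂ tt) λ j → ≈-sym (named i j))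
    (≈-trans (≈-sym (≤0⇒≈ (satisfies (axiom (right (axiom (diag cell)))) ι (λ ()))))
             (op-cong (inj₂ tt) λ i → named i i))
    where
    ι : V → Carrier
    ι = assign₂ (read (λ i → as i i)) as
    named : ∀ i j → ι (cell i j) ≈ as i j
    named i j = MetricSpace-≡⇒≈ space (assign₂-cell _ as i j)

-- Powers

module _ {Σ : Signature ℓ} (A : Algebra Σ) (E : Set ℓ) where
  private module A = Algebra A

  powerAlgebra : Algebra Σ
  powerAlgebra = record
    { space     = A.space ^ E
    ; op        = λ f gs e → A.op f (λ i → gs i e)
    ; op-nonexp = λ f _ _ q k e → A.op-nonexp f _ _ q (λ i → k i e)
    }

  private module P = Algebra powerAlgebra

  ⟦⟧-power : ∀ ι (t : Term Σ V) e → P.⟦ t ⟧ ι e A.≈ A.⟦ t ⟧ (λ v → ι v e)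
  ⟦⟧-power ι (var v)    e = A.≈-refl
  ⟦⟧-power ι (app f ts) e = A.op-cong f (λ i → ⟦⟧-power ι (ts i) e)

  -- A supremum is bounded exactly when every coordinate is, so hypotheses and conclusion can be
  -- compared one coordinate at a time.
  power-satisfies : ∀ {c} → A.Satisfies c → P.Satisfies c
  power-satisfies {_ ⊢ t =[ _ ] s} sat ι hyp e =
    d-resp-≈ A.space (A.≈-sym (⟦⟧-power ι t e)) (A.≈-sym (⟦⟧-power ι s e))
      (sat (λ v → ι v e) λ { {t′ =[ _ ] s′} ψ∈Γ →
        d-resp-≈ A.space (⟦⟧-power ι t′ e) (⟦⟧-power ι s′ e) (hyp ψ∈Γ e) })

-- The reader operation on powers

module _ {n : ℕ} {E : Set ℓ} (E-finite : Fin n ↔ E) where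
  private module E = Inverse E-finite

  readerAlgebra : MetricSpace ℓ → Algebra (ReaderSig n)
  readerAlgebra X = record
    { space     = X ^ E
    ; op        = λ _ gs e → gs (E.from e) e
    ; op-nonexp = λ _ _ _ _ k e → k (E.from e) e
    }

  readerModel : MetricSpace ℓ → Model (𝓡 n)
  readerModel X = closureModel R (ReaderAxiom n) λ
    -- At `e`, every read selects the argument of index `E.from e`, so both sides agree by
    -- computation.
    { (idem x) _ _ → R.≈⇒≤ 0≥0 R.≈-refl
    ; (diag x) _ _ → R.≈⇒≤ 0≥0 R.≈-refl
    }
    where
    R = readerAlgebra X
    module R = Algebra R

  module _ {Σ : Signature ℓ} {𝒰 : Theory Σ} where

    powerModel : Model 𝒰 → Model (𝒰 ⊗ 𝓡 n)
    powerModel A = tensorModel algebra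
      (λ {c} c∈𝒰 → power-satisfies A.algebra E {c} (A.satisfies c∈𝒰))
      (Model.satisfies (readerModel A.space))
      -- `P.op` works inside a coordinate while `R.op` only selects an argument there, so the two
      -- orders reduce to the same element.
      (λ _ _ _ _ → A.≈-refl)
      where
      module A = Model A
      module P = Algebra (powerAlgebra A.algebra E)
      module R = Algebra (readerAlgebra A.space)
      algebra : Algebra (Σ ⊎ˢ ReaderSig n)
      algebra = record
        { space     = A.space ^ E
        ; op        = λ { (inj₁ f) → P.op f         ; (inj₂ g) → R.op g }
        ; op-nonexp = λ { (inj₁ f) → P.op-nonexp f ; (inj₂ g) → R.op-nonexp g }
        }

    -- The comparison maps and their inverse laws

    private
      module U = Free 𝒰
      module W = Free (𝒰 ⊗ 𝓡 n)
      S = readerComposite (freeMonad 𝒰) E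
      T = freeMonad (𝒰 ⊗ 𝓡 n)
      module S = Monad S
      module T = Monad T
      module TU = Monad (freeMonad 𝒰)
      module TX X = Model (W.freeModel X)
      module UX X = Model (U.freeModel X)

    -- Defined by freeness rather than as an inclusion of terms, so that non-expansiveness comes
    -- from `extend`.
    embed : ∀ X → NonExpansive (U.freeSpace X) (W.freeSpace X)
    embed X = map₁ (U.extend (modelˡ (W.freeModel X)) (W.unitᶠ X))

    embed-natural : ∀ {X Y} (f : NonExpansive X Y) t →
      TX._≈_ Y (fun (embed Y) (fun (TU.F₁ f) t)) (fun (T.F₁ f) (fun (embed X) t))
    embed-natural {Y = Y} f (var x)    = TX.≈-refl Y
    embed-natural {Y = Y} f (app k ts) =
      TX.op-cong Y (inj₁ k) (λ i → embed-natural f (ts i))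

    reify : ∀ X → NonExpansive (U.freeSpace X ^ E) (W.freeSpace X)
    reify X = record
      { fun    = λ g → read (W.freeModel X) (λ i → fun (embed X) (g (E.to i)))
      ; nonexp = λ g h q p → TX.op-nonexp X (inj₂ tt) _ _ q
          (λ i → nonexp (embed X) _ _ q (p (E.to i)))
      }

    -- Commutation carries the reads at the leaves outward through every operation of `Σ`, leaving a
    -- single outermost read.
    reify-μ : ∀ X (t : Term Σ ∣ S.F₀ X ∣) →
      TX._≈_ X (fun (T.μ X) (fun (embed (T.F₀ X)) (fun (TU.F₁ (reify X)) t)))
               (fun (reify X) (λ e → fun (TU.μ X) (fun (TU.F₁ (ev {X = TU.F₀ X} e)) t)))
    reify-μ X (var g)    = TX.≈-refl X
    reify-μ X (app f ts) = TX.≈-trans X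
      (TX.op-cong X (inj₁ f) (λ i → reify-μ X (ts i)))
      (model-commuting (W.freeModel X) f tt _)

    reifyMorphism : MonadMorphism S T
    reifyMorphism = record
      { σ       = reify
      ; natural = λ {_} {Y} f g →
          TX.op-cong Y (inj₂ tt) (λ i → embed-natural f (g (E.to i)))
      ; unit    = λ {X} x → read-const (W.freeModel X) (var x)
      ; mult    = λ {X} g → TX.≈-sym X (TX.≈-trans X
          (TX.op-cong X (inj₂ tt) (λ i → reify-μ X (g (E.to i))))
          -- The diagonal of the nested reads evaluates `g e` at the same `e`, as the composite
          -- multiplication does.
          (read-diag (W.freeModel X) _))
      }

    reflect : ∀ X → NonExpansive (W.freeSpace X) (U.freeSpace X ^ E)
    reflect X = map₁ (W.extend (powerModel (U.freeModel X)) (S.η X))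

    -- An embedded term contains no read, and the operations of `Σ` act coordinatewise, so the
    -- constant families at the leaves stay constant.
    reflect-embed : ∀ X t e → UX._≈_ X (fun (reflect X) (fun (embed X) t) e) t
    reflect-embed X (var x)    e = UX.≈-refl X
    reflect-embed X (app f ts) e = UX.op-cong X f (λ i → reflect-embed X (ts i) e)

    reflect-reify : ∀ X g e → UX._≈_ X (fun (reflect X) (fun (reify X) g) e) (g e)
    reflect-reify X g e = UX.≈-trans X (reflect-embed X _ e)
      (MetricSpace-≡⇒≈ (U.freeSpace X) (≡.cong g (E.strictlyInverseˡ e)))

    reify-reflect : ∀ X t → TX._≈_ X (fun (reify X) (fun (reflect X) t)) t
    reify-reflect X (var x)           = read-const (W.freeModel X) (var x)
    reify-reflect X (app (inj₁ f) ts) = TX.≈-trans X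
      (TX.≈-sym X (model-commuting (W.freeModel X) f tt _))
      (TX.op-cong X (inj₁ f) (λ i → reify-reflect X (ts i)))
    reify-reflect X (app (inj₂ tt) ts) =
      -- Once the index is back to `i`, this is the diagonal of a matrix whose row `i`, when read,
      -- is `reify` of `reflect` at `ts i`; expanding it makes induction applicable.
      TX.≈-trans X (TX.op-cong X (inj₂ tt) λ i →
        MetricSpace-≡⇒≈ (W.freeSpace X)
          (≡.cong (λ j → fun (embed X) (fun (reflect X) (ts j) (E.to i)))
                  (E.strictlyInverseʳ i)))
      (TX.≈-trans X (TX.≈-sym X (read-diag (W.freeModel X) _))
                    (TX.op-cong X (inj₂ tt) (λ i → reify-reflect X (ts i))))

corollary6p19 : ∀ {ℓ} (n : ℕ) (E : Set ℓ) → Fin n ↔ E →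
    (Σ : Signature ℓ) (𝒰 : Theory Σ) → Basic 𝒰 →
    MonadIso (readerComposite (freeMonad 𝒰) E) (freeMonad (𝒰 ⊗ 𝓡 n))
corollary6p19 n E E-finite Σ 𝒰 _ =
  invertibleMorphism⇒iso (reifyMorphism E-finite) (reflect E-finite)
    (λ {X} → reflect-reify E-finite X) (λ {X} → reify-reflect E-finite X)
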